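{- Let $D$ be a sink-free digraph which has no induced subdigraph isomorphic to $\vec{K}_{4,1}$ and no induced subdigraph isomorphic to $\vec{K}_{4,1}^+$. Then $D$ has a quasi-kernel of size at most $|V(D)|/2$.
   Context: A quasi-kernel of a digraph $D$ is an independent set $Q\subseteq V(D)$ such that for every vertex $v\in V(D)\setminus Q$ there is a directed path with one or two arcs from $v$ to some vertex of $Q$. A sink is a vertex with no out-neighbour; $D$ is sink-free if it has no sink. $\vec{K}_{4,1}$ is the digraph on five vertices $a_1,a_2,a_3,a_4,c$ whose arcs are exactly $a_1c,a_2c,a_3c,a_4c$. $\vec{K}_{4,1}^+$ is the digraph obtained from $\vec{K}_{4,1}$ by adding exactly one arc between two of the vertices $a_i$ (say the arc $a_1a_2$). -}

module Defs where

open import Data.Nat using (ℕ; _*_; _≤_)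
open import Data.Fin using (Fin; zero; suc)
open import Data.Fin.Subset using (Subset; _∈_; _∉_; ∣_∣)
open import Data.Bool using (Bool; true; false)
open import Data.Product using (Σ; ∃; ∃-syntax; _×_)
open import Data.Sum using (_⊎_)
open import Relation.Binary.PropositionalEquality using (_≡_)
open import Function.Definitions using (Injective)

-- A (finite, loopless) digraph on vertex set Fin n; arcs given by a Boolean
-- adjacency relation (a vertex pair has an arc u→v iff arc u v ≡ true).
-- Opposite arcs (digons) are allowed; no multiple arcs, no loops.
record Digraph (n : ℕ) : Set where
  field
    arc      : Fin n → Fin n → Bool
    loopless : ∀ v → arc v v ≡ false
open Digraph public

module _ {n : ℕ} (D : Digraph n) where

  Arc : Fin n → Fin n → Set
  Arc u v = arc D u v ≡ true

  SinkFree : Set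
  SinkFree = ∀ v → ∃[ u ] Arc v u

  Independent : Subset n → Set
  Independent Q = ∀ u v → u ∈ Q → v ∈ Q → arc D u v ≡ false

  Reach≤2 : Fin n → Fin n → Set
  Reach≤2 v q = Arc v q ⊎ (∃[ w ] (Arc v w × Arc w q))

  QuasiKernel : Subset n → Set
  QuasiKernel Q = Independent Q × (∀ v → v ∉ Q → ∃[ q ] (q ∈ Q × Reach≤2 v q))

  HasInducedCopy : {k : ℕ} → (Fin k → Fin k → Bool) → Set
  HasInducedCopy {k} H =
    Σ (Fin k → Fin n) λ f → Injective _≡_ _≡_ f × (∀ i j → arc D (f i) (f j) ≡ H i j)

-- K⃗_{4,1}: vertices 0,1,2,3 = a₁..a₄, vertex 4 = c; arcs aᵢ → c.
K41 : Fin 5 → Fin 5 → Bool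
K41 zero                         (suc (suc (suc (suc zero)))) = true
K41 (suc zero)                   (suc (suc (suc (suc zero)))) = true
K41 (suc (suc zero))             (suc (suc (suc (suc zero)))) = true
K41 (suc (suc (suc zero)))       (suc (suc (suc (suc zero)))) = true
K41 _ _ = false

K41+ : Fin 5 → Fin 5 → Bool
K41+ zero (suc zero) = true
K41+ i j = K41 i j

{-# OPTIONS --safe #-}

-- Let Q be any quasi-kernel, A = N⁻(Q) and Z the remaining vertices.  Let I be a quasi-kernel of
-- D[Z] whose closed in-neighbourhood in Z is as large as possible, Z₁ = N⁻(I) ∩ Z and
-- Z₂ = Z ∖ N⁻[I].  Pruning Q in one way, and the part Q′ of Q without arcs to I in another way
-- before adding I, gives two quasi-kernels Q₁ ⊆ Q and Q₂ ⊆ Q′ ∪ I.  Only the vertices of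
-- C = { c ∈ Q′ : N⁺(c) ⊆ Z₂ } may have to be kept in both, and the other savings give
-- |Q₁| + |Q₂| ≤ |Q| + |A| + |I| + |C|.  So it suffices that |C| ≤ |Z₁| + |Z₂|.
--
-- Let L be a quasi-kernel of D[Z₂], chosen like I, and M = N⁻[L] ∩ Z₂; comparing I with
-- (I ∖ N⁻(L)) ∪ L gives |M| ≤ |Z₁|.  Every z ∈ Z₂ has an in-neighbour x ∈ I, otherwise z could be
-- added to I.  Three in-neighbours of z in C and x would form a K⃗₄,₁ at z, so z has at most two.
-- If z ∉ M, then z also has an in-neighbour e ∈ L; two in-neighbours in C without arcs to M,
-- together with x and e, would form a K⃗₄,₁ or (if x → e) a K⃗₄,₁⁺.  Hence
-- |C| ≤ 2|M| + |Z₂ ∖ M| ≤ |Z₁| + |Z₂|.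
module Submission where

open import Defs
open import Data.Nat using (ℕ; zero; suc; _+_; _*_; _≤_; _<_; z≤n; s≤s; _<?_)
open import Data.Nat.Properties hiding (suc-injective)
open import Data.Nat.Induction using (<-wellFounded)
open import Data.Nat.Solver using (module +-*-Solver)
open import Data.Fin using (Fin; zero; suc)
open import Data.Fin.Patterns using (0F; 1F; 2F; 3F; 4F)
open import Data.Fin.Properties using (any?; suc-injective)
open import Data.Fin.Subset
open import Data.Fin.Subset.Properties
open import Data.Bool using (Bool; true; false)
open import Data.Bool.Properties using (¬-not) renaming (_≟_ to _≟ᵇ_)
open import Data.Vec using ([]; _∷_; here; there; tabulate; lookup)
open import Data.Vec.Properties using ([]=⇒lookup; lookup⇒[]=; lookup∘tabulate)
open import Data.Vec.Relation.Unary.All using ([]; _∷_)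
open import Data.Vec.Relation.Unary.AllPairs using ([]; _∷_)
open import Data.Vec.Relation.Unary.Unique.Propositional.Properties using (lookup-injective)
open import Data.Product using (Σ; ∃; ∃-syntax; _×_; _,_; proj₁; proj₂)
open import Data.Sum using (_⊎_; inj₁; inj₂)
open import Data.Empty using () renaming (⊥ to ∅)
open import Function using (_∘_)
open import Function.Definitions using (Injective)
open import Induction.WellFounded using (Acc; acc)
open import Relation.Nullary using (¬_; Dec; yes; no; does; contradiction)
open import Relation.Nullary.Decidable using (_×-dec_; dec-true)
open import Relation.Unary using (Pred; Decidable)
open import Relation.Binary.PropositionalEquality

private
  variable
    n m k : ℕ
    p q r : Subset n

-- Cardinalities of finite subsets.

x∈p─q⇒x∉q : ∀ {x} (p q : Subset n) → x ∈ p ─ q → x ∉ q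
x∈p─q⇒x∉q (_ ∷ p) (outside ∷ q) (there x∈) (there x∈q) = x∈p─q⇒x∉q p q x∈ x∈q
x∈p─q⇒x∉q (_ ∷ p) (inside  ∷ q) (there x∈) (there x∈q) = x∈p─q⇒x∉q p q x∈ x∈q

∣p∪q∣≤∣p∣+∣q∣ : ∀ (p q : Subset n) → ∣ p ∪ q ∣ ≤ ∣ p ∣ + ∣ q ∣
∣p∪q∣≤∣p∣+∣q∣ []            []            = z≤n
∣p∪q∣≤∣p∣+∣q∣ (outside ∷ p) (outside ∷ q) = ∣p∪q∣≤∣p∣+∣q∣ p q
∣p∪q∣≤∣p∣+∣q∣ (outside ∷ p) (inside  ∷ q) =
  ≤-trans (s≤s (∣p∪q∣≤∣p∣+∣q∣ p q)) (≤-reflexive (sym (+-suc ∣ p ∣ ∣ q ∣)))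
∣p∪q∣≤∣p∣+∣q∣ (inside  ∷ p) (outside ∷ q) = s≤s (∣p∪q∣≤∣p∣+∣q∣ p q)
∣p∪q∣≤∣p∣+∣q∣ (inside  ∷ p) (inside  ∷ q) =
  s≤s (≤-trans (∣p∪q∣≤∣p∣+∣q∣ p q) (+-monoʳ-≤ ∣ p ∣ (n≤1+n ∣ q ∣)))

∣q∣+∣p─q∣≤∣p∣ : ∀ (p q : Subset n) → q ⊆ p → ∣ q ∣ + ∣ p ─ q ∣ ≤ ∣ p ∣
∣q∣+∣p─q∣≤∣p∣ []            []            _   = z≤n
∣q∣+∣p─q∣≤∣p∣ (outside ∷ p) (outside ∷ q) q⊆p = ∣q∣+∣p─q∣≤∣p∣ p q (drop-∷-⊆ q⊆p)
∣q∣+∣p─q∣≤∣p∣ (outside ∷ p) (inside  ∷ q) q⊆p with () ← q⊆p here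
∣q∣+∣p─q∣≤∣p∣ (inside  ∷ p) (outside ∷ q) q⊆p =
  ≤-trans (≤-reflexive (+-suc ∣ q ∣ ∣ p ─ q ∣)) (s≤s (∣q∣+∣p─q∣≤∣p∣ p q (drop-∷-⊆ q⊆p)))
∣q∣+∣p─q∣≤∣p∣ (inside  ∷ p) (inside  ∷ q) q⊆p = s≤s (∣q∣+∣p─q∣≤∣p∣ p q (drop-∷-⊆ q⊆p))

disjoint⇒∣p∣+∣q∣≤∣r∣ : p ⊆ r → q ⊆ r → (∀ {x} → x ∈ p → x ∉ q) → ∣ p ∣ + ∣ q ∣ ≤ ∣ r ∣
disjoint⇒∣p∣+∣q∣≤∣r∣ {p = p} {r = r} p⊆r q⊆r p#q =
  ≤-trans (+-monoʳ-≤ ∣ p ∣ (p⊆q⇒∣p∣≤∣q∣ λ x∈q → x∈p∧x∉q⇒x∈p─q (q⊆r x∈q) λ x∈p → p#q x∈p x∈q))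
          (∣q∣+∣p─q∣≤∣p∣ r p p⊆r)

∣p∣≤∣p∩q∣+∣p─q∣ : ∀ (p q : Subset n) → ∣ p ∣ ≤ ∣ p ∩ q ∣ + ∣ p ─ q ∣
∣p∣≤∣p∩q∣+∣p─q∣ p q = ≤-trans (p⊆q⇒∣p∣≤∣q∣ split) (∣p∪q∣≤∣p∣+∣q∣ (p ∩ q) (p ─ q))
  where
  split : p ⊆ (p ∩ q) ∪ (p ─ q)
  split {x} x∈p with x ∈? q
  ... | yes x∈q = x∈p∪q⁺ (inj₁ (x∈p∩q⁺ (x∈p , x∈q)))
  ... | no  x∉q = x∈p∪q⁺ (inj₂ (x∈p∧x∉q⇒x∈p─q x∈p x∉q))

∣p∩q∣+∣p─q∣≤∣p∣ : ∀ (p q : Subset n) → ∣ p ∩ q ∣ + ∣ p ─ q ∣ ≤ ∣ p ∣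
∣p∩q∣+∣p─q∣≤∣p∣ p q = disjoint⇒∣p∣+∣q∣≤∣r∣ (p∩q⊆p p q) (p─q⊆p p q)
  λ x∈∩ x∈─ → x∈p─q⇒x∉q p q x∈─ (p∩q⊆q p q x∈∩)

-- Unions of families, distinct elements, and maximisation.

⋃[_] : Subset k → (Fin k → Subset n) → Subset n
⋃[ [] ]          S = ⊥
⋃[ outside ∷ B ] S = ⋃[ B ] (S ∘ suc)
⋃[ inside  ∷ B ] S = S zero ∪ ⋃[ B ] (S ∘ suc)

x∈⋃⁺ : ∀ {B : Subset k} {S : Fin k → Subset n} {i x} → i ∈ B → x ∈ S i → x ∈ ⋃[ B ] S
x∈⋃⁺ {B = inside  ∷ B} here        x∈Si = x∈p∪q⁺ (inj₁ x∈Si)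
x∈⋃⁺ {B = outside ∷ B} (there i∈B) x∈Si = x∈⋃⁺ i∈B x∈Si
x∈⋃⁺ {B = inside  ∷ B} (there i∈B) x∈Si = x∈p∪q⁺ (inj₂ (x∈⋃⁺ i∈B x∈Si))

x∈⋃⁻ : ∀ (B : Subset k) {S : Fin k → Subset n} {x} → x ∈ ⋃[ B ] S → ∃[ i ] (i ∈ B × x ∈ S i)
x∈⋃⁻ []            x∈ = contradiction x∈ ∉⊥
x∈⋃⁻ (outside ∷ B) x∈ with i , i∈B , x∈Si ← x∈⋃⁻ B x∈ = suc i , there i∈B , x∈Si
x∈⋃⁻ (inside  ∷ B) {S} x∈ with x∈p∪q⁻ (S zero) _ x∈
... | inj₁ x∈S0 = zero , here , x∈S0
... | inj₂ x∈⋃ with i , i∈B , x∈Si ← x∈⋃⁻ B x∈⋃ = suc i , there i∈B , x∈Si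

∣⋃∣≤ : ∀ (B : Subset k) {S : Fin k → Subset n} → (∀ {i} → i ∈ B → ∣ S i ∣ ≤ m) → ∣ ⋃[ B ] S ∣ ≤ ∣ B ∣ * m
∣⋃∣≤ {n = n} []    S≤m = ≤-reflexive (∣⊥∣≡0 n)
∣⋃∣≤ (outside ∷ B) S≤m = ∣⋃∣≤ B (S≤m ∘ there)
∣⋃∣≤ (inside  ∷ B) {S} S≤m =
  ≤-trans (∣p∪q∣≤∣p∣+∣q∣ (S zero) _) (+-mono-≤ (S≤m here) (∣⋃∣≤ B {S ∘ suc} (S≤m ∘ there)))

choose-distinct : ∀ (p : Subset n) → k ≤ ∣ p ∣ → ∃[ f ] (Injective {A = Fin k} _≡_ _≡_ f × (∀ i → f i ∈ p))
choose-distinct {k = zero}  p k≤ = (λ ()) , (λ { {()} }) , λ ()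
choose-distinct {k = suc k} (outside ∷ p) k≤ with f , inj , f∈ ← choose-distinct p k≤ =
  suc ∘ f , inj ∘ suc-injective , there ∘ f∈
choose-distinct {k = suc k} (inside ∷ p) (s≤s k≤) with f , inj , f∈ ← choose-distinct p k≤ =
  g , g-inj , g∈
  where
  g : Fin (suc k) → Fin _
  g zero    = zero
  g (suc i) = suc (f i)
  g-inj : Injective _≡_ _≡_ g
  g-inj {zero}  {zero}  _  = refl
  g-inj {suc i} {suc j} eq = cong suc (inj (suc-injective eq))
  g∈ : ∀ i → g i ∈ inside ∷ p
  g∈ zero    = here
  g∈ (suc i) = there (f∈ i)

argmax : ∀ {ℓ} {P : Pred (Subset n) ℓ} → Decidable P → (μ : Subset n → ℕ) (b : ℕ) → (∀ s → μ s ≤ b) →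
  ∃ P → ∃[ s ] (P s × (∀ t → P t → μ t ≤ μ s))
-- Every improvement raises `μ` by at least one and uses one unit of fuel, so `b ≤ μ s + fuel`
-- persists. With no fuel left `μ s` has reached `b`, and no further improvement is possible.
argmax {n} {P = P} P? μ b μ≤b (s₀ , Ps₀) = go b s₀ Ps₀ (m≤n+m b (μ s₀))
  where
  go : ∀ fuel s → P s → b ≤ μ s + fuel → ∃[ s ] (P s × (∀ t → P t → μ t ≤ μ s))
  go fuel s Ps b≤ with anySubset? (λ t → P? t ×-dec (μ s <? μ t))
  ... | no  none = s , Ps , λ t Pt → ≮⇒≥ λ lt → none (t , Pt , lt)
  go zero s Ps b≤ | yes (t , Pt , lt) =
    contradiction (≤-trans lt (≤-trans (μ≤b t) (≤-trans b≤ (≤-reflexive (+-identityʳ _))))) (<-irrefl refl)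
  go (suc fuel) s Ps b≤ | yes (t , Pt , lt) =
    go fuel t Pt (≤-trans b≤ (≤-trans (≤-reflexive (+-suc (μ s) fuel)) (+-monoˡ-≤ fuel lt)))

-- Both forbidden digraphs as one family, indexed by whether the arc from `a₁` to `a₂` is present,
-- so that a copy needs to be checked only once.
K41± : Bool → Fin 5 → Fin 5 → Bool
K41± t zero (suc zero) = t
K41± t i    j          = K41 i j

K41±-false : ∀ i j → K41± false i j ≡ K41 i j
K41±-false zero    zero          = refl
K41±-false zero    (suc zero)    = refl
K41±-false zero    (suc (suc j)) = refl
K41±-false (suc i) j             = refl

K41±-true : ∀ i j → K41± true i j ≡ K41+ i j
K41±-true zero    zero          = refl
K41±-true zero    (suc zero)    = refl
K41±-true zero    (suc (suc j)) = refl
K41±-true (suc i) j             = refl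

-- In-neighbourhoods and stable sets.

module _ {n : ℕ} (D : Digraph n) where

  private
    variable
      U W X Y : Subset n
      u v x z c d : Fin n

  N⁻? : ∀ (X : Subset n) v → Dec (∃[ x ] (x ∈ X × Arc D v x))
  N⁻? X v = any? λ x → (x ∈? X) ×-dec (arc D v x ≟ᵇ true)

  abstract
    N⁻ : Subset n → Subset n
    N⁻ X = tabulate λ v → does (N⁻? X v)

    N⁻⁺ : x ∈ X → Arc D v x → v ∈ N⁻ X
    N⁻⁺ {X = X} {v = v} x∈X vx = lookup⇒[]= v (N⁻ X)
      (trans (lookup∘tabulate _ v) (dec-true (N⁻? X v) (_ , x∈X , vx)))

    N⁻⁻ : v ∈ N⁻ X → ∃[ x ] (x ∈ X × Arc D v x)
    N⁻⁻ {v = v} {X = X} v∈ with N⁻? X v | trans (sym (lookup∘tabulate (λ v → does (N⁻? X v)) v)) ([]=⇒lookup v∈)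
    ... | yes w | _ = w

  N⁻[_] : Subset n → Subset n
  N⁻[ X ] = X ∪ N⁻ X

  ∉N⁻ : v ∉ N⁻ X → x ∈ X → arc D v x ≡ false
  ∉N⁻ v∉ x∈X = ¬-not λ vx → v∉ (N⁻⁺ x∈X vx)

  N⁻-singleton : v ∈ N⁻ ⁅ x ⁆ → Arc D v x
  N⁻-singleton v∈ with y , y∈ , vy ← N⁻⁻ v∈ with refl ← x∈⁅y⁆⇒x≡y _ y∈ = vy

  X⊆N⁻[X] : X ⊆ N⁻[ X ]
  X⊆N⁻[X] = p⊆p∪q _

  N⁻X⊆N⁻[X] : N⁻ X ⊆ N⁻[ X ]
  N⁻X⊆N⁻[X] {X} = q⊆p∪q X _

  N⁻-mono : X ⊆ Y → N⁻ X ⊆ N⁻ Y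
  N⁻-mono X⊆Y v∈ with x , x∈X , vx ← N⁻⁻ v∈ = N⁻⁺ (X⊆Y x∈X) vx

  N⁻[]-mono : X ⊆ Y → N⁻[ X ] ⊆ N⁻[ Y ]
  N⁻[]-mono {X} {Y} X⊆Y v∈ with x∈p∪q⁻ X _ v∈
  ... | inj₁ v∈X  = X⊆N⁻[X] (X⊆Y v∈X)
  ... | inj₂ v∈N⁻ = N⁻X⊆N⁻[X] {Y} (N⁻-mono X⊆Y v∈N⁻)

  ∉N⁻[]⇒∉ : v ∉ N⁻[ X ] → v ∉ X
  ∉N⁻[]⇒∉ v∉ = v∉ ∘ X⊆N⁻[X]

  ∉N⁻[]⇒∉N⁻ : v ∉ N⁻[ X ] → v ∉ N⁻ X
  ∉N⁻[]⇒∉N⁻ {X = X} v∉ = v∉ ∘ N⁻X⊆N⁻[X] {X}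

  Stable : Subset n → Set
  Stable X = X ⊆ ∁ (N⁻ X)

  -- The paths that reach X may leave U.
  QK : Subset n → Subset n → Set
  QK U X = X ⊆ U × Stable X × U ⊆ N⁻[ N⁻[ X ] ]

  QK? : ∀ U → Decidable (QK U)
  QK? U X = (X ⊆? U) ×-dec ((X ⊆? ∁ (N⁻ X)) ×-dec (U ⊆? N⁻[ N⁻[ X ] ]))

  stable-∪ : Stable X → Stable Y → (∀ {v} → v ∈ X → v ∉ N⁻ Y) → (∀ {v} → v ∈ Y → v ∉ N⁻ X) → Stable (X ∪ Y)
  stable-∪ {X} {Y} stX stY XY YX {v} v∈ = x∉p⇒x∈∁p λ v∈N → go (x∈p∪q⁻ X Y v∈) (N⁻⁻ v∈N)
    where
    go : v ∈ X ⊎ v ∈ Y → ¬ (∃[ x ] (x ∈ X ∪ Y × Arc D v x))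
    go v∈ (x , x∈ , vx) with v∈ | x∈p∪q⁻ X Y x∈
    ... | inj₁ v∈X | inj₁ x∈X = x∈∁p⇒x∉p (stX v∈X) (N⁻⁺ x∈X vx)
    ... | inj₁ v∈X | inj₂ x∈Y = XY v∈X (N⁻⁺ x∈Y vx)
    ... | inj₂ v∈Y | inj₁ x∈X = YX v∈Y (N⁻⁺ x∈X vx)
    ... | inj₂ v∈Y | inj₂ x∈Y = x∈∁p⇒x∉p (stY v∈Y) (N⁻⁺ x∈Y vx)

  stable-⊆ : X ⊆ Y → Stable Y → Stable X
  stable-⊆ X⊆Y st v∈X = x∉p⇒x∈∁p (x∈∁p⇒x∉p (st (X⊆Y v∈X)) ∘ N⁻-mono X⊆Y)

  stable-singleton : Stable ⁅ v ⁆
  stable-singleton {v} {u} u∈ with refl ← x∈⁅y⁆⇒x≡y v u∈ =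
    x∉p⇒x∈∁p λ vv → no-loop (N⁻-singleton vv)
    where
    no-loop : ¬ Arc D v v
    no-loop vv with () ← trans (sym vv) (loopless D v)

  -- Exchange and existence of quasi-kernels.

  rest : Subset n → Subset n → Subset n
  rest U X = U ─ N⁻[ X ]

  rest⇒∈ : v ∈ rest U X → v ∈ U
  rest⇒∈ = p─q⊆p _ _

  rest⇒∉N⁻[] : v ∈ rest U X → v ∉ N⁻[ X ]
  rest⇒∉N⁻[] = x∈p─q⇒x∉q _ _

  -- A vertex of `X` is dropped only if it has an arc into `W`.
  swap⊆ : X ⊆ N⁻[ W ∪ (X ─ N⁻ W) ]
  swap⊆ {X} {W} {v} v∈X with v ∈? N⁻ W
  ... | yes v∈N = N⁻X⊆N⁻[X] {W ∪ _} (N⁻-mono (p⊆p∪q _) v∈N)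
  ... | no  v∉N = X⊆N⁻[X] (q⊆p∪q W _ (x∈p∧x∉q⇒x∈p─q v∈X v∉N))

  -- `W` avoids `N⁻[ X ]`, so it sends no arcs to `X`; deleting `N⁻ W` from `X` removes the arcs in
  -- the other direction. By `swap⊆`, whatever was in `N⁻[ X ]` is still within two steps.
  QK-swap : X ⊆ U → Stable X → QK (rest U X) W → QK U (W ∪ (X ─ N⁻ W))
  QK-swap {X} {U} {W} X⊆U stX (W⊆ , stW , cover) = sub , st , cov
    where
    sub : W ∪ (X ─ N⁻ W) ⊆ U
    sub v∈ with x∈p∪q⁻ W _ v∈
    ... | inj₁ v∈W = rest⇒∈ (W⊆ v∈W)
    ... | inj₂ v∈X = X⊆U (p─q⊆p X _ v∈X)
    st : Stable (W ∪ (X ─ N⁻ W))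
    st = stable-∪ stW (stable-⊆ (p─q⊆p X _) stX)
      (λ v∈W v∈N → ∉N⁻[]⇒∉N⁻ {X = X} (rest⇒∉N⁻[] {U = U} (W⊆ v∈W)) (N⁻-mono (p─q⊆p X _) v∈N))
      (x∈p─q⇒x∉q X _)
    cov : U ⊆ N⁻[ N⁻[ W ∪ (X ─ N⁻ W) ] ]
    cov {v} v∈U with v ∈? N⁻[ X ]
    ... | yes v∈N = N⁻[]-mono swap⊆ v∈N
    ... | no  v∉N = N⁻[]-mono (N⁻[]-mono (p⊆p∪q _)) (cover (x∈p∧x∉q⇒x∈p─q v∈U v∉N))

  -- The Chvátal-Lovász theorem, by the usual induction: delete the closed in-neighbourhood of a
  -- vertex `v`, solve the rest, and put `v` back unless it has an arc into the solution.
  QK-exists : ∀ U → ∃ (QK U)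
  QK-exists U = go U (<-wellFounded _)
    where
    go : ∀ U → Acc _<_ ∣ U ∣ → ∃ (QK U)
    go U (acc rec) with nonempty? U
    ... | no  empty = ⊥ , (λ v∈ → contradiction v∈ ∉⊥) , (λ v∈ → contradiction v∈ ∉⊥) , λ v∈U → contradiction (_ , v∈U) empty
    ... | yes (v , v∈U) =
      let v∈N = x∈⁅x⁆ v
          W , qkW = go (rest U ⁅ v ⁆) (rec (p∩q≢∅⇒∣p─q∣<∣p∣ U _ (v , x∈p∩q⁺ (v∈U , X⊆N⁻[X] v∈N))))
      in _ , QK-swap (λ u∈ → subst (_∈ U) (sym (x∈⁅y⁆⇒x≡y v u∈)) v∈U) stable-singleton qkW

  -- Quasi-kernels with largest closed in-neighbourhood.

  Maximal : Subset n → Subset n → Set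
  Maximal U X = ∀ Y → QK U Y → ∣ U ∩ N⁻[ Y ] ∣ ≤ ∣ U ∩ N⁻[ X ] ∣

  abstract
    maximal-QK : ∀ U → ∃[ X ] (QK U X × Maximal U X)
    maximal-QK U = argmax (QK? U) (λ X → ∣ U ∩ N⁻[ X ] ∣) n (λ X → ∣p∣≤n (U ∩ N⁻[ X ])) (QK-exists U)

  -- Since `v` has no arc into `X`, an absent in-neighbour would leave `X ∪ ⁅ v ⁆` stable, and its
  -- closed in-neighbourhood would gain `v`.
  maximal⇒in-neighbour : QK U X → Maximal U X → v ∈ rest U X → ∃[ x ] (x ∈ X × Arc D x v)
  maximal⇒in-neighbour {U} {X} {v} (X⊆U , st , cover) max v∈R
    with any? (λ x → (x ∈? X) ×-dec (arc D x v ≟ᵇ true))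
  ... | yes found = found
  ... | no  none  = contradiction (max (X ∪ ⁅ v ⁆) qk) (<⇒≱ (p⊂q⇒∣p∣<∣q∣ bigger))
    where
    qk : QK U (X ∪ ⁅ v ⁆)
    qk = (λ u∈ → sub (x∈p∪q⁻ X _ u∈))
       , stable-∪ st stable-singleton (λ u∈X u∈N → none (_ , u∈X , N⁻-singleton u∈N)) v↛X
       , λ u∈U → N⁻[]-mono (N⁻[]-mono (p⊆p∪q _)) (cover u∈U)
      where
      sub : ∀ {u} → u ∈ X ⊎ u ∈ ⁅ v ⁆ → u ∈ U
      sub (inj₁ u∈X) = X⊆U u∈X
      sub (inj₂ u∈v) = subst (_∈ U) (sym (x∈⁅y⁆⇒x≡y v u∈v)) (rest⇒∈ v∈R)
      v↛X : ∀ {u} → u ∈ ⁅ v ⁆ → u ∉ N⁻ X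
      v↛X u∈v with refl ← x∈⁅y⁆⇒x≡y v u∈v = ∉N⁻[]⇒∉N⁻ {X = X} (rest⇒∉N⁻[] {U = U} v∈R)
    bigger : U ∩ N⁻[ X ] ⊂ U ∩ N⁻[ X ∪ ⁅ v ⁆ ]
    bigger = (λ u∈ → let u∈U , u∈N = x∈p∩q⁻ U _ u∈ in x∈p∩q⁺ (u∈U , N⁻[]-mono (p⊆p∪q _) u∈N))
           , v , x∈p∩q⁺ (rest⇒∈ v∈R , X⊆N⁻[X] (q⊆p∪q X _ (x∈⁅x⁆ v)))
           , λ v∈ → rest⇒∉N⁻[] {U = U} v∈R (p∩q⊆q U _ v∈)

  -- Exchange `X` for `W ∪ (X ─ N⁻ W)`: the closed in-neighbourhood keeps `X`, gains the part of the
  -- rest near `W`, and can lose only vertices of `U ∩ N⁻ X`. By maximality the gain is at most this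
  -- possible loss.
  maximal⇒rest-bound : QK U X → Maximal U X → QK (rest U X) W → ∣ rest U X ∩ N⁻[ W ] ∣ ≤ ∣ U ∩ N⁻ X ∣
  maximal⇒rest-bound {U} {X} {W} (X⊆U , st , _) max qkW = +-cancelˡ-≤ ∣ X ∣ _ _ (begin
    ∣ X ∣ + ∣ rest U X ∩ N⁻[ W ] ∣   ≤⟨ disjoint⇒∣p∣+∣q∣≤∣r∣ X⊆ R⊆ X#R ⟩
    ∣ U ∩ N⁻[ W ∪ (X ─ N⁻ W) ] ∣     ≤⟨ max _ (QK-swap X⊆U st qkW) ⟩
    ∣ U ∩ N⁻[ X ] ∣                  ≤⟨ p⊆q⇒∣p∣≤∣q∣ split ⟩
    ∣ X ∪ (U ∩ N⁻ X) ∣               ≤⟨ ∣p∪q∣≤∣p∣+∣q∣ X _ ⟩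
    ∣ X ∣ + ∣ U ∩ N⁻ X ∣             ∎)
    where
    open ≤-Reasoning
    X⊆ : X ⊆ U ∩ N⁻[ W ∪ (X ─ N⁻ W) ]
    X⊆ x∈X = x∈p∩q⁺ (X⊆U x∈X , swap⊆ x∈X)
    R⊆ : rest U X ∩ N⁻[ W ] ⊆ U ∩ N⁻[ W ∪ (X ─ N⁻ W) ]
    R⊆ v∈ = let v∈R , v∈N = x∈p∩q⁻ (rest U X) _ v∈ in x∈p∩q⁺ (rest⇒∈ v∈R , N⁻[]-mono (p⊆p∪q _) v∈N)
    X#R : ∀ {v} → v ∈ X → v ∉ rest U X ∩ N⁻[ W ]
    X#R v∈X v∈ = rest⇒∉N⁻[] {U = U} (p∩q⊆p (rest U X) _ v∈) (X⊆N⁻[X] v∈X)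
    split : U ∩ N⁻[ X ] ⊆ X ∪ (U ∩ N⁻ X)
    split v∈ with v∈U , v∈N ← x∈p∩q⁻ U _ v∈ with x∈p∪q⁻ X _ v∈N
    ... | inj₁ v∈X = x∈p∪q⁺ (inj₁ v∈X)
    ... | inj₂ v∈N⁻ = x∈p∪q⁺ (inj₂ (x∈p∩q⁺ (v∈U , v∈N⁻)))

  -- Counting along arcs.

  partition-bound : X ⊆ U → Stable X → ∣ X ∣ + (∣ U ∩ N⁻ X ∣ + ∣ rest U X ∣) ≤ ∣ U ∣
  partition-bound {X} {U} X⊆U st = begin
    ∣ X ∣ + (∣ U ∩ N⁻ X ∣ + ∣ rest U X ∣)   ≡⟨ +-assoc ∣ X ∣ _ _ ⟨
    ∣ X ∣ + ∣ U ∩ N⁻ X ∣ + ∣ rest U X ∣     ≤⟨ +-monoˡ-≤ _ (disjoint⇒∣p∣+∣q∣≤∣r∣ X⊆ U⊆ X#N) ⟩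
    ∣ U ∩ N⁻[ X ] ∣ + ∣ rest U X ∣          ≤⟨ ∣p∩q∣+∣p─q∣≤∣p∣ U N⁻[ X ] ⟩
    ∣ U ∣                                   ∎
    where
    open ≤-Reasoning
    X⊆ : X ⊆ U ∩ N⁻[ X ]
    X⊆ v∈X = x∈p∩q⁺ (X⊆U v∈X , X⊆N⁻[X] v∈X)
    U⊆ : U ∩ N⁻ X ⊆ U ∩ N⁻[ X ]
    U⊆ v∈ = let v∈U , v∈N = x∈p∩q⁻ U _ v∈ in x∈p∩q⁺ (v∈U , N⁻X⊆N⁻[X] {X} v∈N)
    X#N : ∀ {v} → v ∈ X → v ∉ U ∩ N⁻ X
    X#N v∈X v∈ = x∈∁p⇒x∉p (st v∈X) (p∩q⊆q U _ v∈)

  fibre-bound : X ⊆ N⁻ Y → (∀ {y} → y ∈ Y → ∣ X ∩ N⁻ ⁅ y ⁆ ∣ ≤ k) → ∣ X ∣ ≤ ∣ Y ∣ * k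
  fibre-bound {X} {Y} X⊆N⁻Y fibre≤k = ≤-trans (p⊆q⇒∣p∣≤∣q∣ cover) (∣⋃∣≤ Y fibre≤k)
    where
    cover : X ⊆ ⋃[ Y ] (λ y → X ∩ N⁻ ⁅ y ⁆)
    cover v∈X with y , y∈Y , vy ← N⁻⁻ (X⊆N⁻Y v∈X) =
      x∈⋃⁺ y∈Y (x∈p∩q⁺ (v∈X , N⁻⁺ (x∈⁅x⁆ y) vy))

  -- One out-neighbour in `X` is chosen for each vertex of `Y`; coinciding choices only help.
  dominators : ∀ Y X → Y ⊆ N⁻ X → ∃[ E ] (E ⊆ X × Y ⊆ N⁻ E × ∣ E ∣ ≤ ∣ Y ∣)
  dominators Y X Y⊆N⁻X =
      ⋃[ Y ] out
    , (λ x∈ → let y , y∈Y , x∈out = x∈⋃⁻ Y x∈ in out⊆X y x∈out)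
    , (λ {y} y∈Y → let x , x∈out , yx = out-arc (Y⊆N⁻X y∈Y) in N⁻⁺ (x∈⋃⁺ y∈Y x∈out) yx)
    , ≤-trans (∣⋃∣≤ Y (λ {y} _ → ∣out∣≤1 y)) (≤-reflexive (*-identityʳ _))
    where
    out : Fin n → Subset n
    -- The witness found by the decision procedure serves as the choice function; the empty set is
    -- the default outside `N⁻ X`.
    out y with N⁻? X y
    ... | yes (x , _) = ⁅ x ⁆
    ... | no  _       = ⊥
    out⊆X : ∀ y → out y ⊆ X
    out⊆X y x∈ with N⁻? X y
    ... | yes (x , x∈X , _) = subst (_∈ X) (sym (x∈⁅y⁆⇒x≡y x x∈)) x∈X
    ... | no  _             = contradiction x∈ ∉⊥
    out-arc : ∀ {y} → y ∈ N⁻ X → ∃[ x ] (x ∈ out y × Arc D y x)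
    out-arc {y} y∈N with N⁻? X y
    ... | yes (x , _ , yx) = x , x∈⁅x⁆ x , yx
    ... | no  none         = contradiction (N⁻⁻ y∈N) none
    ∣out∣≤1 : ∀ y → ∣ out y ∣ ≤ 1
    ∣out∣≤1 y with N⁻? X y
    ... | yes (x , _) = ≤-reflexive (∣⁅x⁆∣≡1 x)
    ... | no  _       = ≤-trans (≤-reflexive (∣⊥∣≡0 n)) z≤n

  QK⇒QuasiKernel : QK ⊤ X → QuasiKernel D X
  QK⇒QuasiKernel {X} (_ , st , cover) =
      (λ u v u∈X v∈X → ∉N⁻ (x∈∁p⇒x∉p (st u∈X)) v∈X)
    , λ v v∉X → reach v∉X (x∈p∪q⁻ N⁻[ X ] _ (cover {v} ∈⊤))
    where
    reach : ∀ {v} → v ∉ X → v ∈ N⁻[ X ] ⊎ v ∈ N⁻ N⁻[ X ] → ∃[ q ] (q ∈ X × Reach≤2 D v q)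
    direct : ∀ {v} → v ∈ N⁻ X → ∃[ q ] (q ∈ X × Reach≤2 D v q)
    direct v∈N with q , q∈X , vq ← N⁻⁻ v∈N = q , q∈X , inj₁ vq
    reach v∉X (inj₁ v∈) with x∈p∪q⁻ X _ v∈
    ... | inj₁ v∈X = contradiction v∈X v∉X
    ... | inj₂ v∈N = direct v∈N
    reach v∉X (inj₂ v∈) with w , w∈ , vw ← N⁻⁻ v∈ with x∈p∪q⁻ X _ w∈
    ... | inj₁ w∈X = w , w∈X , inj₁ vw
    ... | inj₂ w∈N with q , q∈X , wq ← N⁻⁻ w∈N = q , q∈X , inj₂ (w , vw , wq)

  -- Induced stars.

  _∥_ : Fin n → Fin n → Set
  u ∥ v = u ≢ v × arc D u v ≡ false × arc D v u ≡ false

  -- The centre of an induced star sends no arc back to a leaf, so digons have to be excluded.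
  _⊳_ : Fin n → Fin n → Set
  u ⊳ v = Arc D u v × arc D v u ≡ false

  ⊳⇒≢ : u ⊳ v → u ≢ v
  ⊳⇒≢ {u} (uv , vu) refl with () ← trans (sym uv) vu

  -- Only the arc from `a` to `b` is left open: without it the five vertices induce `K41`, with it
  -- `K41+`.
  no-star : ¬ HasInducedCopy D K41 → ¬ HasInducedCopy D K41+ → ∀ {a b c d z} →
    a ≢ b → arc D b a ≡ false → a ∥ c → a ∥ d → b ∥ c → b ∥ d → c ∥ d →
    a ⊳ z → b ⊳ z → c ⊳ z → d ⊳ z → ∅
  no-star noK noK+ {a} {b} {c} {d} {z} a≢b ba (a≢c , ac , ca) (a≢d , ad , da) (b≢c , bc , cb)
    (b≢d , bd , db) (c≢d , cd , dc) a⊳z@(az , za) b⊳z@(bz , zb) c⊳z@(cz , zc) d⊳z@(dz , zd) =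
    finish _ refl
    where
    f : Fin 5 → Fin n
    f = lookup (a ∷ b ∷ c ∷ d ∷ z ∷ [])
    f-injective : Injective _≡_ _≡_ f
    f-injective {i} {j} = lookup-injective
      ( (a≢b ∷ a≢c ∷ a≢d ∷ ⊳⇒≢ a⊳z ∷ [])
      ∷ (b≢c ∷ b≢d ∷ ⊳⇒≢ b⊳z ∷ [])
      ∷ (c≢d ∷ ⊳⇒≢ c⊳z ∷ [])
      ∷ (⊳⇒≢ d⊳z ∷ [])
      ∷ [] ∷ []) i j
    f-arc : ∀ i j → arc D (f i) (f j) ≡ K41± (arc D a b) i j
    f-arc 0F 0F = loopless D a
    f-arc 0F 1F = refl
    f-arc 0F 2F = ac
    f-arc 0F 3F = ad
    f-arc 0F 4F = az
    f-arc 1F 0F = ba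
    f-arc 1F 1F = loopless D b
    f-arc 1F 2F = bc
    f-arc 1F 3F = bd
    f-arc 1F 4F = bz
    f-arc 2F 0F = ca
    f-arc 2F 1F = cb
    f-arc 2F 2F = loopless D c
    f-arc 2F 3F = cd
    f-arc 2F 4F = cz
    f-arc 3F 0F = da
    f-arc 3F 1F = db
    f-arc 3F 2F = dc
    f-arc 3F 3F = loopless D d
    f-arc 3F 4F = dz
    f-arc 4F 0F = za
    f-arc 4F 1F = zb
    f-arc 4F 2F = zc
    f-arc 4F 3F = zd
    f-arc 4F 4F = loopless D z
    finish : ∀ t → arc D a b ≡ t → ∅
    finish false ab = noK (f , f-injective , λ i j →
      trans (f-arc i j) (trans (cong (λ t → K41± t i j) ab) (K41±-false i j)))
    finish true ab = noK+ (f , f-injective , λ i j →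
      trans (f-arc i j) (trans (cong (λ t → K41± t i j) ab) (K41±-true i j)))

  -- The sets attached to a quasi-kernel `Q`.

  module Construction (sinkFree : SinkFree D) (noK : ¬ HasInducedCopy D K41) (noK+ : ¬ HasInducedCopy D K41+)
    (Q : Subset n) (qkQ : QK ⊤ Q) where

    -- `K` is the part of `Q′` that `Q₂` keeps outright: its vertices have no arc to `Z₁` or `A′`,
    -- through which they could reach `Q₂`. `C` is the part of `K` that `Q₁` must keep as well,
    -- having no arc to `A`. `Q₁` keeps all of `Q″`.
    A Z I Z₁ Z₂ L M Q′ Q″ A′ K C : Subset n
    A = N⁻ Q
    Z = rest ⊤ Q
    I = proj₁ (maximal-QK Z)
    Z₁ = Z ∩ N⁻ I
    Z₂ = rest Z I
    L = proj₁ (maximal-QK Z₂)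
    M = Z₂ ∩ N⁻[ L ]
    Q′ = Q ─ N⁻ I
    A′ = A ∩ N⁻ Q′
    K = Q′ ─ N⁻ (Z₁ ∪ A′)
    C = K ─ N⁻ A
    Q″ = Q ─ K

    qkI : QK Z I
    qkI = proj₁ (proj₂ (maximal-QK Z))
    maxI : Maximal Z I
    maxI = proj₂ (proj₂ (maximal-QK Z))
    qkL : QK Z₂ L
    qkL = proj₁ (proj₂ (maximal-QK Z₂))
    maxL : Maximal Z₂ L
    maxL = proj₂ (proj₂ (maximal-QK Z₂))

    stQ : Stable Q
    stQ = proj₁ (proj₂ qkQ)
    I⊆Z : I ⊆ Z
    I⊆Z = proj₁ qkI
    stI : Stable I
    stI = proj₁ (proj₂ qkI)

    K⊆Q′ : K ⊆ Q′
    K⊆Q′ = p─q⊆p Q′ _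
    Q′⊆Q : Q′ ⊆ Q
    Q′⊆Q = p─q⊆p Q _
    K⊆Q : K ⊆ Q
    K⊆Q = Q′⊆Q ∘ K⊆Q′
    C⊆K : C ⊆ K
    C⊆K = p─q⊆p K _

    Z-split : z ∈ Z → z ∉ Q × z ∉ A
    Z-split z∈Z = ∉N⁻[]⇒∉ z∉ , ∉N⁻[]⇒∉N⁻ {X = Q} z∉
      where z∉ = rest⇒∉N⁻[] {U = ⊤} z∈Z

    Z₂⊆Z : Z₂ ⊆ Z
    Z₂⊆Z = rest⇒∈ {U = Z}

    Z₂-split : z ∈ Z₂ → z ∉ I × z ∉ N⁻ I
    Z₂-split z∈Z₂ = ∉N⁻[]⇒∉ z∉ , ∉N⁻[]⇒∉N⁻ {X = I} z∉
      where z∉ = rest⇒∉N⁻[] {U = Z} z∈Z₂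

    C-split : c ∈ C → c ∈ Q × c ∉ N⁻ I × c ∉ N⁻ (Z₁ ∪ A′) × c ∉ A × c ∉ N⁻ A
    C-split c∈C = K⊆Q c∈K , x∈p─q⇒x∉q Q _ (K⊆Q′ c∈K) , x∈p─q⇒x∉q Q′ _ c∈K
      , x∈∁p⇒x∉p (stQ (K⊆Q c∈K)) , x∈p─q⇒x∉q K _ c∈C
      where c∈K = C⊆K c∈C

    -- Sink-freeness enters here: `c` has some out-neighbour, and `Q`, `A`, `I` and `Z₁` are all
    -- excluded.
    C⊆N⁻Z₂ : C ⊆ N⁻ Z₂
    C⊆N⁻Z₂ {c} c∈C with w , cw ← sinkFree c | c∈Q , c∉N⁻I , c∉N⁻ , c∉A , c∉N⁻A ← C-split c∈C
      with w ∈? N⁻[ Q ]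
    ... | yes w∈N with x∈p∪q⁻ Q _ w∈N
    ...   | inj₁ w∈Q = contradiction (N⁻⁺ w∈Q cw) c∉A
    ...   | inj₂ w∈A = contradiction (N⁻⁺ w∈A cw) c∉N⁻A
    C⊆N⁻Z₂ {c} c∈C | no w∉N with w ∈? N⁻[ I ]
    ... | no  w∉N[I] = N⁻⁺ (x∈p∧x∉q⇒x∈p─q (x∈p∧x∉q⇒x∈p─q ∈⊤ w∉N) w∉N[I]) cw
    ... | yes w∈N[I] with x∈p∪q⁻ I _ w∈N[I]
    ...   | inj₁ w∈I = contradiction (N⁻⁺ w∈I cw) c∉N⁻I
    ...   | inj₂ w∈N = contradiction
            (N⁻⁺ (x∈p∪q⁺ (inj₁ (x∈p∩q⁺ (x∈p∧x∉q⇒x∈p─q ∈⊤ w∉N , w∈N)))) cw) c∉N⁻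

    -- Bounding `C` by forbidden stars.

    C∥C : c ∈ C → d ∈ C → c ≢ d → c ∥ d
    C∥C c∈C d∈C c≢d with c∈Q , _ , _ , c∉A , _ ← C-split c∈C | d∈Q , _ , _ , d∉A , _ ← C-split d∈C =
      c≢d , ∉N⁻ c∉A d∈Q , ∉N⁻ d∉A c∈Q

    -- `Z` avoids `N⁻[ Q ]` and `C` lies in `Q`, so arcs between them can only go from `C` to `Z`.
    Z∥C : z ∈ Z → c ∈ C → arc D c z ≡ false → z ∥ c
    Z∥C z∈Z c∈C cz with z∉Q , z∉A ← Z-split z∈Z | c∈Q , _ ← C-split c∈C =
      (λ { refl → z∉Q c∈Q }) , ∉N⁻ z∉A c∈Q , cz

    I∥C : x ∈ I → c ∈ C → x ∥ c
    I∥C x∈I c∈C = Z∥C (I⊆Z x∈I) c∈C (∉N⁻ (proj₁ (proj₂ (C-split c∈C))) x∈I)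

    C⊳Z : c ∈ C → z ∈ Z → Arc D c z → c ⊳ z
    C⊳Z c∈C z∈Z cz = cz , ∉N⁻ (proj₂ (Z-split z∈Z)) (proj₁ (C-split c∈C))

    I⊳Z₂ : z ∈ Z₂ → ∃[ x ] (x ∈ I × x ⊳ z)
    I⊳Z₂ z∈Z₂ with x , x∈I , xz ← maximal⇒in-neighbour qkI maxI z∈Z₂ =
      x , x∈I , xz , ∉N⁻ (proj₂ (Z₂-split z∈Z₂)) x∈I

    fibre≤2 : z ∈ M → ∣ (C ∩ N⁻ M) ∩ N⁻ ⁅ z ⁆ ∣ ≤ 2
    fibre≤2 {z} z∈M = ≮⇒≥ λ 3≤ → absurd (choose-distinct _ 3≤)
      where
      z∈Z₂ : z ∈ Z₂
      z∈Z₂ = p∩q⊆p Z₂ _ z∈M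
      absurd : ¬ (∃[ f ] (Injective {A = Fin 3} _≡_ _≡_ f × (∀ i → f i ∈ (C ∩ N⁻ M) ∩ N⁻ ⁅ z ⁆)))
      absurd (f , inj , f∈) with x , x∈I , x⊳z ← I⊳Z₂ z∈Z₂ =
        -- The leaves are `x` and three vertices of `C`, pairwise non-adjacent.
        no-star noK noK+ (proj₁ (I∥ 0F)) (proj₂ (proj₂ (I∥ 0F))) (I∥ 1F) (I∥ 2F)
          (C∥C (f∈C 0F) (f∈C 1F) (f≢ λ ())) (C∥C (f∈C 0F) (f∈C 2F) (f≢ λ ())) (C∥C (f∈C 1F) (f∈C 2F) (f≢ λ ()))
          x⊳z (f⊳ 0F) (f⊳ 1F) (f⊳ 2F)
        where
        f∈C : ∀ i → f i ∈ C
        f∈C i = p∩q⊆p C _ (p∩q⊆p (C ∩ N⁻ M) _ (f∈ i))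
        I∥ : ∀ i → x ∥ f i
        I∥ i = I∥C x∈I (f∈C i)
        f≢ : ∀ {i j} → i ≢ j → f i ≢ f j
        f≢ i≢j = i≢j ∘ inj
        f⊳ : ∀ i → f i ⊳ z
        f⊳ i = C⊳Z (f∈C i) (Z₂⊆Z z∈Z₂) (N⁻-singleton (p∩q⊆q (C ∩ N⁻ M) _ (f∈ i)))

    fibre≤1 : z ∈ rest Z₂ L → ∣ (C ─ N⁻ M) ∩ N⁻ ⁅ z ⁆ ∣ ≤ 1
    fibre≤1 {z} z∈R = ≮⇒≥ λ 2≤ → absurd (choose-distinct _ 2≤)
      where
      z∈Z₂ : z ∈ Z₂
      z∈Z₂ = rest⇒∈ {U = Z₂} z∈R
      absurd : ¬ (∃[ f ] (Injective {A = Fin 2} _≡_ _≡_ f × (∀ i → f i ∈ (C ─ N⁻ M) ∩ N⁻ ⁅ z ⁆)))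
      absurd (f , inj , f∈) with x , x∈I , x⊳z ← I⊳Z₂ z∈Z₂ | e , e∈L , ez ← maximal⇒in-neighbour qkL maxL z∈R =
        -- The order of `x` and `e` matters: `e` lies in `Z₂`, so it has no arc to `x`, while `x`
        -- may have one to `e`. Since `e` is in `M`, the chosen vertices of `C` have no arc to it.
        no-star noK noK+ (λ { refl → proj₁ (Z₂-split e∈Z₂) x∈I }) (∉N⁻ (proj₂ (Z₂-split e∈Z₂)) x∈I)
          (I∥ 0F) (I∥ 1F) (e∥ 0F) (e∥ 1F) (C∥C (f∈C 0F) (f∈C 1F) λ eq → 0≢1 (inj eq))
          x⊳z (ez , ∉N⁻ (∉N⁻[]⇒∉N⁻ {X = L} (rest⇒∉N⁻[] {U = Z₂} z∈R)) e∈L) (f⊳ 0F) (f⊳ 1F)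
        where
        e∈Z₂ : e ∈ Z₂
        e∈Z₂ = proj₁ qkL e∈L
        e∈M : e ∈ M
        e∈M = x∈p∩q⁺ (e∈Z₂ , X⊆N⁻[X] e∈L)
        0≢1 : 0F ≢ 1F
        0≢1 ()
        f∈─ : ∀ i → f i ∈ C ─ N⁻ M
        f∈─ i = p∩q⊆p (C ─ N⁻ M) _ (f∈ i)
        f∈C : ∀ i → f i ∈ C
        f∈C i = p─q⊆p C _ (f∈─ i)
        I∥ : ∀ i → x ∥ f i
        I∥ i = I∥C x∈I (f∈C i)
        e∥ : ∀ i → e ∥ f i
        e∥ i = Z∥C (Z₂⊆Z e∈Z₂) (f∈C i) (∉N⁻ (x∈p─q⇒x∉q C _ (f∈─ i)) e∈M)
        f⊳ : ∀ i → f i ⊳ z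
        f⊳ i = C⊳Z (f∈C i) (Z₂⊆Z z∈Z₂) (N⁻-singleton (p∩q⊆q (C ─ N⁻ M) _ (f∈ i)))

    C-bound : ∣ C ∣ ≤ ∣ Z₁ ∣ + ∣ Z₂ ∣
    C-bound = begin
      ∣ C ∣                                    ≤⟨ ∣p∣≤∣p∩q∣+∣p─q∣ C (N⁻ M) ⟩
      ∣ C ∩ N⁻ M ∣ + ∣ C ─ N⁻ M ∣              ≤⟨ +-mono-≤ (fibre-bound (p∩q⊆q C _) fibre≤2)
                                                           (fibre-bound outside-M fibre≤1) ⟩
      ∣ M ∣ * 2 + ∣ rest Z₂ L ∣ * 1            ≡⟨ solve 2 (λ m r → m :* con 2 :+ r :* con 1 := m :+ (m :+ r)) refl (∣ M ∣) _ ⟩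
      -- One copy of `M` is paid for by `Z₁`; the other completes `rest Z₂ L` to `Z₂`.
      ∣ M ∣ + (∣ M ∣ + ∣ rest Z₂ L ∣)          ≤⟨ +-mono-≤ (maximal⇒rest-bound qkI maxI qkL)
                                                           (∣p∩q∣+∣p─q∣≤∣p∣ Z₂ N⁻[ L ]) ⟩
      ∣ Z₁ ∣ + ∣ Z₂ ∣                          ∎
      where
      open ≤-Reasoning
      open +-*-Solver
      outside-M : C ─ N⁻ M ⊆ N⁻ (rest Z₂ L)
      outside-M {c} c∈ with w , w∈Z₂ , cw ← N⁻⁻ (C⊆N⁻Z₂ (p─q⊆p C _ c∈)) with w ∈? N⁻[ L ]
      ... | yes w∈N = contradiction (N⁻⁺ (x∈p∩q⁺ (w∈Z₂ , w∈N)) cw) (x∈p─q⇒x∉q C _ c∈)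
      ... | no  w∉N = N⁻⁺ (x∈p∧x∉q⇒x∈p─q w∈Z₂ w∉N) cw

    -- The two quasi-kernels `Q₁` and `Q₂`.

    vertex-cases : ∀ v → v ∈ Q ⊎ v ∈ A ⊎ v ∈ Z
    vertex-cases v with v ∈? N⁻[ Q ]
    ... | no  v∉ = inj₂ (inj₂ (x∈p∧x∉q⇒x∈p─q ∈⊤ v∉))
    ... | yes v∈ with x∈p∪q⁻ Q _ v∈
    ...   | inj₁ v∈Q = inj₁ v∈Q
    ...   | inj₂ v∈A = inj₂ (inj₁ v∈A)

    -- A vertex of `Z` reaches `Q` in two steps but not in one, so its first step ends in `A`.
    Z⊆N⁻A : Z ⊆ N⁻ A
    Z⊆N⁻A {z} z∈Z with z∉Q , z∉A ← Z-split z∈Z with x∈p∪q⁻ N⁻[ Q ] _ (proj₂ (proj₂ qkQ) {z} ∈⊤)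
    ... | inj₁ z∈ = contradiction z∈ (rest⇒∉N⁻[] {U = ⊤} z∈Z)
    ... | inj₂ z∈ with w , w∈ , zw ← N⁻⁻ z∈ with x∈p∪q⁻ Q _ w∈
    ...   | inj₁ w∈Q = contradiction (N⁻⁺ w∈Q zw) z∉A
    ...   | inj₂ w∈A = N⁻⁺ w∈A zw

    -- Replaces `K` in `Q₁` as a dominating set of `A`; vertices of `A` without arcs to `K` are
    -- dominated by `Q″`.
    first : ∃[ E ] (E ⊆ K × A ∩ N⁻ K ⊆ N⁻ E × ∣ E ∣ ≤ ∣ A ∩ N⁻ K ∣)
    first = dominators (A ∩ N⁻ K) K (p∩q⊆q A _)

    -- Since `K` stays in `Q₂`, only the vertices of `A′` without arcs to `K` need new dominators.
    -- They are disjoint from those handled by `first`, so both choices together cost at most `A`.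
    second : ∃[ E ] (E ⊆ Q′ × A′ ─ N⁻ K ⊆ N⁻ E × ∣ E ∣ ≤ ∣ A′ ─ N⁻ K ∣)
    second = dominators (A′ ─ N⁻ K) Q′ (λ a∈ → p∩q⊆q A _ (p─q⊆p A′ _ a∈))

    E₁ E₂ Q₁ Q₂ : Subset n
    E₁ = proj₁ first
    E₂ = proj₁ second
    Q₁ = Q″ ∪ (C ∪ E₁)
    Q₂ = I ∪ (K ∪ E₂)

    -- All of `A` keeps an arc into `Q₁`, which covers `Z` through `Z⊆N⁻A`. A vertex of `K` outside
    -- `C` has an arc to `A` by the choice of `C`.
    qkQ₁ : QK ⊤ Q₁
    qkQ₁ = ⊆⊤ , stable-⊆ sub stQ , λ {v} _ → cover (vertex-cases v)
      where
      sub : Q₁ ⊆ Q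
      sub v∈ with x∈p∪q⁻ Q″ _ v∈
      ... | inj₁ v∈Q″ = p─q⊆p Q _ v∈Q″
      ... | inj₂ v∈∪ with x∈p∪q⁻ C _ v∈∪
      ...   | inj₁ v∈C = K⊆Q (C⊆K v∈C)
      ...   | inj₂ v∈E = K⊆Q (proj₁ (proj₂ first) v∈E)
      A⊆ : A ⊆ N⁻ Q₁
      A⊆ {a} a∈A with a ∈? N⁻ K
      ... | yes a∈N = N⁻-mono (q⊆p∪q Q″ _ ∘ q⊆p∪q C _) (proj₁ (proj₂ (proj₂ first)) (x∈p∩q⁺ (a∈A , a∈N)))
      ... | no  a∉N with q , q∈Q , aq ← N⁻⁻ a∈A =
        N⁻⁺ (p⊆p∪q _ (x∈p∧x∉q⇒x∈p─q q∈Q λ q∈K → a∉N (N⁻⁺ q∈K aq))) aq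
      N⁻A⊆ : N⁻ A ⊆ N⁻[ N⁻[ Q₁ ] ]
      N⁻A⊆ v∈ = N⁻X⊆N⁻[X] {N⁻[ Q₁ ]} (N⁻-mono (N⁻X⊆N⁻[X] {Q₁} ∘ A⊆) v∈)
      cover : v ∈ Q ⊎ v ∈ A ⊎ v ∈ Z → v ∈ N⁻[ N⁻[ Q₁ ] ]
      cover (inj₂ (inj₁ v∈A)) = X⊆N⁻[X] (N⁻X⊆N⁻[X] {Q₁} (A⊆ v∈A))
      cover (inj₂ (inj₂ v∈Z)) = N⁻A⊆ (Z⊆N⁻A v∈Z)
      cover {v} (inj₁ v∈Q) with v ∈? K | v ∈? N⁻ A
      ... | no  v∉K | _       = X⊆N⁻[X] (X⊆N⁻[X] (p⊆p∪q _ (x∈p∧x∉q⇒x∈p─q v∈Q v∉K)))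
      ... | yes v∈K | yes v∈N = N⁻A⊆ v∈N
      ... | yes v∈K | no  v∉N = X⊆N⁻[X] (X⊆N⁻[X] (q⊆p∪q Q″ _ (p⊆p∪q _ (x∈p∧x∉q⇒x∈p─q v∈K v∉N))))

    -- Stability: `Q′` sends no arcs to `I`, and `Z` none to `Q`. A vertex of `A` either goes
    -- through `Q ∩ N⁻ I` to `I`, or lies in `A′` and is dominated by `K ∪ E₂`.
    qkQ₂ : QK ⊤ Q₂
    qkQ₂ = ⊆⊤ , stable-∪ stI (stable-⊆ (Q′⊆Q ∘ sub) stQ) I↛ (x∈p─q⇒x∉q Q _ ∘ sub)
         , λ {v} _ → cover (vertex-cases v)
      where
      sub : K ∪ E₂ ⊆ Q′
      sub v∈ with x∈p∪q⁻ K _ v∈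
      ... | inj₁ v∈K = K⊆Q′ v∈K
      ... | inj₂ v∈E = proj₁ (proj₂ second) v∈E
      I↛ : ∀ {v} → v ∈ I → v ∉ N⁻ (K ∪ E₂)
      I↛ v∈I v∈N = proj₂ (Z-split (I⊆Z v∈I)) (N⁻-mono (Q′⊆Q ∘ sub) v∈N)
      N⁻I⊆ : N⁻ I ⊆ N⁻[ Q₂ ]
      N⁻I⊆ v∈ = N⁻X⊆N⁻[X] {Q₂} (N⁻-mono (p⊆p∪q _) v∈)
      A′⊆ : A′ ⊆ N⁻[ Q₂ ]
      A′⊆ {a} a∈A′ = N⁻X⊆N⁻[X] {Q₂} (N⁻-mono (q⊆p∪q I _) a∈)
        where
        a∈ : a ∈ N⁻ (K ∪ E₂)
        a∈ with a ∈? N⁻ K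
        ... | yes a∈N = N⁻-mono (p⊆p∪q _) a∈N
        ... | no  a∉N = N⁻-mono (q⊆p∪q K _) (proj₁ (proj₂ (proj₂ second)) (x∈p∧x∉q⇒x∈p─q a∈A′ a∉N))
      cover : v ∈ Q ⊎ v ∈ A ⊎ v ∈ Z → v ∈ N⁻[ N⁻[ Q₂ ] ]
      -- The paths given by `qkI` may leave `Z`, which is harmless in a quasi-kernel of the whole
      -- digraph.
      cover (inj₂ (inj₂ v∈Z)) = N⁻[]-mono (N⁻[]-mono (p⊆p∪q _)) (proj₂ (proj₂ qkI) v∈Z)
      cover (inj₂ (inj₁ v∈A)) with q , q∈Q , vq ← N⁻⁻ v∈A with q ∈? N⁻ I
      ... | yes q∈N = N⁻X⊆N⁻[X] {N⁻[ Q₂ ]} (N⁻⁺ (N⁻I⊆ q∈N) vq)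
      ... | no  q∉N = X⊆N⁻[X] (A′⊆ (x∈p∩q⁺ (v∈A , N⁻⁺ (x∈p∧x∉q⇒x∈p─q q∈Q q∉N) vq)))
      cover {v} (inj₁ v∈Q) with v ∈? N⁻ I
      ... | yes v∈N = X⊆N⁻[X] (N⁻I⊆ v∈N)
      ... | no  v∉N with v ∈? N⁻ (Z₁ ∪ A′)
      ...   | no  v∉N⁻ = X⊆N⁻[X] (X⊆N⁻[X] (q⊆p∪q I _ (p⊆p∪q _ (x∈p∧x∉q⇒x∈p─q (x∈p∧x∉q⇒x∈p─q v∈Q v∉N) v∉N⁻))))
      ...   | yes v∈N⁻ = N⁻X⊆N⁻[X] {N⁻[ Q₂ ]} (N⁻-mono near v∈N⁻)
        where
        near : Z₁ ∪ A′ ⊆ N⁻[ Q₂ ]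
        near w∈ with x∈p∪q⁻ Z₁ _ w∈
        ... | inj₁ w∈Z₁ = N⁻I⊆ (p∩q⊆q Z _ w∈Z₁)
        ... | inj₂ w∈A′ = A′⊆ w∈A′

    -- Sizes of `Q₁` and `Q₂`.

    A-bound : ∣ E₁ ∣ + ∣ E₂ ∣ ≤ ∣ A ∣
    A-bound = begin
      ∣ E₁ ∣ + ∣ E₂ ∣                     ≤⟨ +-mono-≤ (proj₂ (proj₂ (proj₂ first))) (proj₂ (proj₂ (proj₂ second))) ⟩
      ∣ A ∩ N⁻ K ∣ + ∣ A′ ─ N⁻ K ∣        ≤⟨ disjoint⇒∣p∣+∣q∣≤∣r∣ (p∩q⊆p A _) (p∩q⊆p A _ ∘ p─q⊆p A′ _)
                                               (λ a∈ a∈′ → x∈p─q⇒x∉q A′ _ a∈′ (p∩q⊆q A _ a∈)) ⟩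
      ∣ A ∣                               ∎
      where open ≤-Reasoning

    -- The pieces are charged to a partition of the vertex set: `K` and `Q″` to `Q`, `E₁` and `E₂`
    -- to `A`, and `I` and `C` to `Z`.
    sum-bound : ∣ Q₁ ∣ + ∣ Q₂ ∣ ≤ n
    sum-bound = begin
      ∣ Q₁ ∣ + ∣ Q₂ ∣
        ≤⟨ +-mono-≤ (∣p∪q∪r∣≤ Q″ C E₁) (∣p∪q∪r∣≤ I K E₂) ⟩
      ∣ Q″ ∣ + (∣ C ∣ + ∣ E₁ ∣) + (∣ I ∣ + (∣ K ∣ + ∣ E₂ ∣))
        ≡⟨ rearrange (∣ Q″ ∣) (∣ C ∣) (∣ E₁ ∣) (∣ I ∣) (∣ K ∣) (∣ E₂ ∣) ⟩
      (∣ K ∣ + ∣ Q″ ∣) + ((∣ E₁ ∣ + ∣ E₂ ∣) + (∣ I ∣ + ∣ C ∣))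
        ≤⟨ +-mono-≤ (∣q∣+∣p─q∣≤∣p∣ Q K K⊆Q) (+-mono-≤ A-bound
             (≤-trans (+-monoʳ-≤ ∣ I ∣ C-bound) (partition-bound I⊆Z stI))) ⟩
      ∣ Q ∣ + (∣ A ∣ + ∣ Z ∣)
        ≡⟨ cong (λ B → ∣ Q ∣ + (∣ B ∣ + ∣ Z ∣)) (∩-identityˡ A) ⟨
      ∣ Q ∣ + (∣ ⊤ ∩ A ∣ + ∣ Z ∣)
        ≤⟨ partition-bound ⊆⊤ stQ ⟩
      ∣ ⊤ {n} ∣
        ≡⟨ ∣⊤∣≡n n ⟩
      n ∎
      where
      open ≤-Reasoning
      rearrange : ∀ q c e i k f → q + (c + e) + (i + (k + f)) ≡ (k + q) + ((e + f) + (i + c))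
      rearrange = solve 6 (λ q c e i k f → q :+ (c :+ e) :+ (i :+ (k :+ f)) := (k :+ q) :+ ((e :+ f) :+ (i :+ c))) refl
        where open +-*-Solver
      ∣p∪q∪r∣≤ : ∀ (p q r : Subset n) → ∣ p ∪ (q ∪ r) ∣ ≤ ∣ p ∣ + (∣ q ∣ + ∣ r ∣)
      ∣p∪q∪r∣≤ p q r = ≤-trans (∣p∪q∣≤∣p∣+∣q∣ p (q ∪ r)) (+-monoʳ-≤ ∣ p ∣ (∣p∪q∣≤∣p∣+∣q∣ q r))

theorem2 : (n : ℕ) (D : Digraph n) → SinkFree D → ¬ HasInducedCopy D K41 → ¬ HasInducedCopy D K41+ →
    Σ (Subset n) λ Q → QuasiKernel D Q × 2 * ∣ Q ∣ ≤ n
theorem2 n D sinkFree noK noK+ = smaller (≤-total ∣ Q₁ ∣ ∣ Q₂ ∣)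
  where
  -- Any initial quasi-kernel works; the smaller of `Q₁` and `Q₂` is the answer.
  open Construction D sinkFree noK noK+ (proj₁ (QK-exists D ⊤)) (proj₂ (QK-exists D ⊤))
  smaller : ∣ Q₁ ∣ ≤ ∣ Q₂ ∣ ⊎ ∣ Q₂ ∣ ≤ ∣ Q₁ ∣ → Σ (Subset n) λ Q → QuasiKernel D Q × 2 * ∣ Q ∣ ≤ n
  smaller (inj₁ Q₁≤Q₂) = Q₁ , QK⇒QuasiKernel D qkQ₁ , (begin
    ∣ Q₁ ∣ + (∣ Q₁ ∣ + 0)  ≡⟨ cong (∣ Q₁ ∣ +_) (+-identityʳ _) ⟩
    ∣ Q₁ ∣ + ∣ Q₁ ∣        ≤⟨ +-monoʳ-≤ ∣ Q₁ ∣ Q₁≤Q₂ ⟩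
    ∣ Q₁ ∣ + ∣ Q₂ ∣        ≤⟨ sum-bound ⟩
    n                      ∎)
    where open ≤-Reasoning
  smaller (inj₂ Q₂≤Q₁) = Q₂ , QK⇒QuasiKernel D qkQ₂ , (begin
    ∣ Q₂ ∣ + (∣ Q₂ ∣ + 0)  ≡⟨ cong (∣ Q₂ ∣ +_) (+-identityʳ _) ⟩
    ∣ Q₂ ∣ + ∣ Q₂ ∣        ≤⟨ +-monoˡ-≤ ∣ Q₂ ∣ Q₂≤Q₁ ⟩
    ∣ Q₁ ∣ + ∣ Q₂ ∣        ≤⟨ sum-bound ⟩
    n                      ∎)
    where open ≤-Reasoning
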